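{- Let $\mathbb{F}$ be a field of characteristic zero, let $n$ be a positive integer, and let $\big(g(x),F(x)\big)$ be an element of the Riordan group $\mathcal{R}(\mathbb{F})$ with $g(x) = g_0 + g_rx^r + g_{r+1}x^{r+1} + \cdots$ and $F(x) = f_1x + f_2x^2 + \cdots$, where $g(x)$ is non-constant ($g_0 \neq 0$, $r > 0$ and $g_r \neq 0$) and $(f_1)^n = 1$. Then $$\big(g(x),F(x)\big)^n = (1,x) \iff g(x)\cdot g\big(F(x)\big)\cdots g\big(F^{(n-1)}(x)\big) = 1.$$
   Context: The Riordan group $\mathcal{R}(\mathbb{F})$ consists of the pairs $\big(g(x),F(x)\big)$ of formal power series over $\mathbb{F}$ with $g(x) = g_0 + g_1x + \cdots$, $g_0 \neq 0$, and $F(x) = f_1x + f_2x^2 + \cdots$, $f_1 \neq 0$ (identified with the infinite lower triangular matrix whose $(m,n)$ entry, $m,n\ge 0$, is the coefficient of $x^m$ in $g(x)F(x)^n$). Multiplication is $\big(g(x),F(x)\big)\cdot\big(h(x),K(x)\big) = \big(g(x)\cdot h(F(x)),\, K(F(x))\big)$, and the identity is $(1,x)$. $F^{(k)}(x)$ denotes the $k$-fold composition $F(F(\cdots F(x)\cdots))$ (with $F^{(0)}(x) = x$), so the product in the claim is $\prod_{j=0}^{n-1} g\big(F^{(j)}(x)\big)$. -}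

module Defs where

open import Level using (Level; _⊔_)
open import Data.Nat.Base using (ℕ; zero; suc; _∸_; NonZero)
open import Data.Fin.Base using (toℕ)
open import Data.Product.Base using (_×_)
open import Algebra.Bundles using (RawSemiring; RawMonoid)
open import Algebra.Apartness.Bundles using (HeytingField)
import Algebra.Definitions.RawMonoid as RawMonoidDefinitions
import Algebra.Definitions.RawSemiring as RawSemiringDefinitions
import Algebra.Apartness.Properties.HeytingCommutativeRing as HeytingProperties

-- "a ≠ 0" is rendered as `a # 0#`, which by the axioms of a `HeytingField`
-- holds exactly when a is invertible.  Classically `#` is the negation of `≈`,
-- and Heyting fields are exactly fields.
module Riordan {c ℓ₁ ℓ₂ : Level} (𝔽 : HeytingField c ℓ₁ ℓ₂) where

  open HeytingField 𝔽
  open HeytingProperties heytingCommutativeRing using (1#0; x#0y#0→xy#0; #-congʳ)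

  rawSemiring : RawSemiring c ℓ₁
  rawSemiring = record
    { _≈_ = _≈_ ; _+_ = _+_ ; _*_ = _*_ ; 0# = 0# ; 1# = 1# }

  open RawSemiringDefinitions rawSemiring public
    using (sum; _^_) renaming (_×_ to _·_)

  CharacteristicZero : Set ℓ₂
  CharacteristicZero = ∀ n → .{{NonZero n}} → (n · 1#) # 0#

  -- `f m` is the coefficient of xᵐ.
  PowerSeries : Set c
  PowerSeries = ℕ → Carrier

  infix 4 _≋_
  _≋_ : PowerSeries → PowerSeries → Set ℓ₁
  f ≋ g = ∀ m → f m ≈ g m

  infixl 6 _⊕_
  _⊕_ : PowerSeries → PowerSeries → PowerSeries
  (f ⊕ g) m = f m + g m

  infixl 7 _⊛_
  _⊛_ : PowerSeries → PowerSeries → PowerSeries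
  (f ⊛ g) m = sum {suc m} λ i → f (toℕ i) * g (m ∸ toℕ i)

  𝟘 : PowerSeries
  𝟘 _ = 0#

  𝟙 : PowerSeries
  𝟙 zero    = 1#
  𝟙 (suc _) = 0#

  X : PowerSeries
  X 1 = 1#
  X _ = 0#

  powerSeries : RawSemiring c ℓ₁
  powerSeries = record
    { _≈_ = _≋_ ; _+_ = _⊕_ ; _*_ = _⊛_ ; 0# = 𝟘 ; 1# = 𝟙 }

  open RawSemiringDefinitions powerSeries public
    using () renaming (_^_ to _^ˢ_; product to ∏)

  -- h ⟪ F ⟫ is the substitution h(F(x)) = Σₖ hₖ F(x)ᵏ, and is only meaningful
  -- for F with zero constant term: Fᵏ then has no terms of degree below k, so
  -- the coefficient of xᵐ only involves k ≤ m.
  infixl 9 _⟪_⟫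
  _⟪_⟫ : PowerSeries → PowerSeries → PowerSeries
  (h ⟪ F ⟫) m = sum {suc m} λ k → h (toℕ k) * (F ^ˢ toℕ k) m

  iterate : PowerSeries → ℕ → PowerSeries
  iterate F zero    = X
  iterate F (suc j) = F ⟪ iterate F j ⟫

  record RiordanPair : Set (c ⊔ ℓ₁ ⊔ ℓ₂) where
    field
      g    : PowerSeries
      F    : PowerSeries
      g₀#0 : g 0 # 0#
      F₀≈0 : F 0 ≈ 0#
      F₁#0 : F 1 # 0#

  infix 4 _≈ᴿ_
  _≈ᴿ_ : RiordanPair → RiordanPair → Set ℓ₁
  A ≈ᴿ B = (A.g ≋ B.g) × (A.F ≋ B.F)
    where
    module A = RiordanPair A
    module B = RiordanPair B

  private
    +0 : ∀ {a} → a + 0# ≈ a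
    +0 = +-identityʳ _

    ^1-coeff : ∀ F → (F ^ˢ 1) 1 ≈ F 1
    ^1-coeff F =
      trans (+-cong (zeroʳ _) (trans +0 (*-identityʳ _))) (+-identityˡ _)

    ⟪⟫-coeff₀ : ∀ h F → (h ⟪ F ⟫) 0 ≈ h 0
    ⟪⟫-coeff₀ h F = trans +0 (*-identityʳ _)

    ⟪⟫-coeff₁ : ∀ h F → (h ⟪ F ⟫) 1 ≈ h 1 * F 1
    ⟪⟫-coeff₁ h F =
      trans (+-cong (zeroʳ _) (trans +0 (*-congˡ (^1-coeff F)))) (+-identityˡ _)

    ⊛-coeff₀ : ∀ f h → (f ⊛ h) 0 ≈ f 0 * h 0
    ⊛-coeff₀ f h = +0

  infixl 7 _∙ᴿ_
  _∙ᴿ_ : RiordanPair → RiordanPair → RiordanPair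
  A ∙ᴿ B = record
    { g    = A.g ⊛ B.g ⟪ A.F ⟫
    ; F    = B.F ⟪ A.F ⟫
    ; g₀#0 = #-congʳ
               (sym (trans (⊛-coeff₀ A.g (B.g ⟪ A.F ⟫)) (*-congˡ (⟪⟫-coeff₀ B.g A.F))))
               (x#0y#0→xy#0 A.g₀#0 B.g₀#0)
    ; F₀≈0 = trans (⟪⟫-coeff₀ B.F A.F) B.F₀≈0
    ; F₁#0 = #-congʳ (sym (⟪⟫-coeff₁ B.F A.F)) (x#0y#0→xy#0 B.F₁#0 A.F₁#0)
    }
    where
    module A = RiordanPair A
    module B = RiordanPair B

  εᴿ : RiordanPair
  εᴿ = record { g = 𝟙 ; F = X ; g₀#0 = 1#0 ; F₀≈0 = refl ; F₁#0 = 1#0 }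

  -- The product and identity of the Riordan group; powers with natural exponents
  -- need nothing more.
  riordan : RawMonoid (c ⊔ ℓ₁ ⊔ ℓ₂) ℓ₁
  riordan = record { _≈_ = _≈ᴿ_ ; _∙_ = _∙ᴿ_ ; ε = εᴿ }

  infixr 8 _^ᴿ_
  _^ᴿ_ : RiordanPair → ℕ → RiordanPair
  A ^ᴿ n = n RiordanMultiple.× A
    where module RiordanMultiple = RawMonoidDefinitions riordan

{-# OPTIONS --safe #-}
module Submission where

open import Defs
open import Data.Nat.Base as ℕ
  using (ℕ; zero; suc; NonZero; _<_; _≤′_; ≤′-refl; ≤′-step; s≤s; s<s; z<s; s<s⁻¹)
import Data.Nat.Properties as ℕ
open import Data.Fin.Base using (Fin; zero; suc; toℕ; fromℕ; inject₁)
open import Data.Fin.Properties using (toℕ-inject₁; toℕ-fromℕ; toℕ<n)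
open import Data.Product.Base using (_,_; proj₁)
open import Data.Sum.Base using (inj₁; inj₂)
open import Function.Base using (_∘_)
open import Function.Bundles using (_⇔_; mk⇔)
open import Relation.Binary.Bundles using (Setoid)
open import Relation.Binary.PropositionalEquality.Core as ≡ using ()
import Relation.Binary.Reasoning.Setoid as SetoidReasoning
open import Algebra.Bundles using (CommutativeMonoid; CommutativeRing; CommutativeSemiring)
open import Algebra.Structures.Biased using (isCommutativeSemiringˡ)
import Algebra.Construct.Pointwise as Pointwise
import Algebra.Properties.CommutativeMonoid.Sum as MonoidSum
import Algebra.Properties.CommutativeSemigroup as CommutativeSemigroupProperties
import Algebra.Properties.Group as GroupProperties
import Algebra.Properties.Semiring.Mult as SemiringMult
import Algebra.Properties.Semiring.Sum as SemiringSum
open import Algebra.Apartness.Bundles using (HeytingField; HeytingCommutativeRing)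
import Algebra.Apartness.Properties.HeytingCommutativeRing as HeytingProperties

-- The j-fold composite F⁽ʲ⁾ is the second component of (g, F)ʲ, and the product
-- P = g·g(F)⋯g(F⁽ⁿ⁻¹⁾) is the first component of (g, F)ⁿ, so only P = 1 ⇒ F⁽ⁿ⁾ = x
-- has content.  P = 1 gives P(F) = 1, and g·P(F) = P·g(F⁽ⁿ⁾),
-- hence g(H) = g for H = F⁽ⁿ⁾ = x + ⋯.  If H = x + d xˢ + ⋯ then the coefficient of x^(r+s-1) in g(H) − g
-- is r g_r d, so d = 0 in characteristic zero, for every s ≥ 2 in turn.

module RiordanPowers {c ℓ₁ ℓ₂} (𝔽 : HeytingField c ℓ₁ ℓ₂) where

  open HeytingField 𝔽 hiding (zero)
  open Riordan 𝔽
  open HeytingProperties heytingCommutativeRing using (x-0≈x; x#0y#0→xy#0)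
  open HeytingCommutativeRing heytingCommutativeRing using (commutativeRing)
  open CommutativeRing commutativeRing
    using (+-commutativeMonoid; +-group; semiring)
  open SemiringSum semiring using (sum-cong-≋; ∑-distrib-+; *-distribˡ-sum; sum-replicate-zero)
  open SemiringMult semiring using (×-assoc-*; ×-congʳ)
  module ≈-Reasoning = SetoidReasoning setoid

  x#0∧xy≈0⇒y≈0 : ∀ {x y} → x # 0# → x * y ≈ 0# → y ≈ 0#
  x#0∧xy≈0⇒y≈0 {x} {y} x#0 xy≈0 with #⇒invertible x#0
  ... | x⁻¹ , x⁻¹x≈1 , _ = begin
    y                  ≈⟨ *-identityˡ y ⟨
    -- `#⇒invertible` inverts `x - 0#` rather than `x`, hence `x-0≈x`.
    1# * y             ≈⟨ *-congʳ (trans (*-congˡ (sym (x-0≈x x))) x⁻¹x≈1) ⟨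
    x⁻¹ * x * y        ≈⟨ *-assoc _ _ _ ⟩
    x⁻¹ * (x * y)      ≈⟨ *-congˡ xy≈0 ⟩
    x⁻¹ * 0#           ≈⟨ zeroʳ x⁻¹ ⟩
    0#                 ∎
    where open ≈-Reasoning

  -- Agreement of power series below a given order

  infix 4 _≋[_]_
  _≋[_]_ : PowerSeries → ℕ → PowerSeries → Set ℓ₁
  f ≋[ n ] g = ∀ i → i < n → f i ≈ g i

  truncated : ℕ → Setoid c ℓ₁
  truncated n = record
    { Carrier = PowerSeries
    ; _≈_ = _≋[ n ]_
    ; isEquivalence = record
      { refl  = λ _ _ → refl
      ; sym   = λ p i i<n → sym (p i i<n)
      ; trans = λ p q i i<n → trans (p i i<n) (q i i<n)
      }
    }

  ≋⇒≋[] : ∀ {f g} n → f ≋ g → f ≋[ n ] g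
  ≋⇒≋[] _ p i _ = p i

  ≋[]⇒≋ : ∀ {f g} → (∀ n → f ≋[ n ] g) → f ≋ g
  ≋[]⇒≋ p i = p (suc i) i (ℕ.n<1+n i)

  ≋[suc] : ∀ {f g n} → f ≋[ n ] g → f n ≈ g n → f ≋[ suc n ] g
  ≋[suc] p q i i<1+n with ℕ.m≤n⇒m<n∨m≡n (ℕ.s≤s⁻¹ i<1+n)
  ... | inj₁ i<n = p i i<n
  ... | inj₂ ≡.refl = q

  -- The commutative semiring of power series

  C : Carrier → PowerSeries
  C a zero    = a
  C a (suc _) = 0#

  𝟙≋C : 𝟙 ≋ C 1#
  𝟙≋C zero    = refl
  𝟙≋C (suc _) = refl

  -- The coefficient at `m` of a product reads its factors only up to `m`. The induction uses that
  -- `(f ⊛ g) (suc m)` computes to `f 0 * g (suc m) + ((f ∘ suc) ⊛ g) m`, a recursion used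
  -- throughout.
  ⊛-cong[] : ∀ n {f f′ g g′} → f ≋[ n ] f′ → g ≋[ n ] g′ → f ⊛ g ≋[ n ] f′ ⊛ g′
  ⊛-cong[] n p q zero    0<n   = +-congʳ (*-cong (p 0 0<n) (q 0 0<n))
  ⊛-cong[] (suc n) p q (suc m) m<n =
    +-cong (*-cong (p 0 z<s) (q (suc m) m<n))
      (⊛-cong[] n (λ i i<n → p (suc i) (s<s i<n)) (λ i i<n → q i (ℕ.m<n⇒m<1+n i<n))
        m (s<s⁻¹ m<n))

  ⊛-cong : ∀ {f f′ g g′} → f ≋ f′ → g ≋ g′ → f ⊛ g ≋ f′ ⊛ g′
  ⊛-cong p q = ≋[]⇒≋ λ n → ⊛-cong[] n (≋⇒≋[] n p) (≋⇒≋[] n q)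

  -- When `f 0` vanishes, the coefficient of `f ⊛ u` at `m` reads `u` only below `m`. This gain of
  -- one order drives the inductions on truncation order.
  ⊛-contractʳ : ∀ n {f u v} → f 0 ≈ 0# → u ≋[ n ] v → f ⊛ u ≋[ suc n ] f ⊛ v
  ⊛-contractʳ n f₀≈0 p zero _ =
    +-congʳ (trans (trans (*-congʳ f₀≈0) (zeroˡ _)) (sym (trans (*-congʳ f₀≈0) (zeroˡ _))))
  ⊛-contractʳ n {f} f₀≈0 p (suc m) m<n = +-cong
    (trans (trans (*-congʳ f₀≈0) (zeroˡ _)) (sym (trans (*-congʳ f₀≈0) (zeroˡ _))))
    (⊛-cong[] n {f ∘ suc} (λ _ _ → refl) p m (s<s⁻¹ m<n))

  ⊛-distribʳ : ∀ h f g → (f ⊕ g) ⊛ h ≋ f ⊛ h ⊕ g ⊛ h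
  ⊛-distribʳ h f g m = trans
    (sum-cong-≋ {suc m} λ i → distribʳ (h (m ℕ.∸ toℕ i)) (f (toℕ i)) (g (toℕ i)))
    (∑-distrib-+ {suc m} (λ i → f (toℕ i) * h (m ℕ.∸ toℕ i)) (λ i → g (toℕ i) * h (m ℕ.∸ toℕ i)))

  ⊛-zeroˡ : ∀ f → 𝟘 ⊛ f ≋ 𝟘
  ⊛-zeroˡ f m = trans (sum-cong-≋ {suc m} λ i → zeroˡ (f (m ℕ.∸ toℕ i))) (sum-replicate-zero (suc m))

  C⊛ : ∀ a f m → (C a ⊛ f) m ≈ a * f m
  C⊛ a f zero    = +-identityʳ _
  C⊛ a f (suc m) = trans (+-congˡ (⊛-zeroˡ f m)) (+-identityʳ _)

  -- The mirror image of the defining recursion, splitting off the last summand instead of the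
  -- first. Playing the two against each other gives commutativity.
  ⊛-suc-last : ∀ f g m → (f ⊛ g) (suc m) ≈ (f ⊛ (g ∘ suc)) m + f (suc m) * g 0
  ⊛-suc-last f g zero    = trans (sym (+-assoc _ _ _)) (trans (+-identityʳ _) (+-congʳ (sym (+-identityʳ _))))
  ⊛-suc-last f g (suc m) = trans (+-congˡ (⊛-suc-last (f ∘ suc) g m)) (sym (+-assoc _ _ _))

  ⊛-comm : ∀ f g → f ⊛ g ≋ g ⊛ f
  ⊛-comm f g zero    = +-congʳ (*-comm _ _)
  ⊛-comm f g (suc m) = begin
    f 0 * g (suc m) + ((f ∘ suc) ⊛ g) m  ≈⟨ +-comm _ _ ⟩
    ((f ∘ suc) ⊛ g) m + f 0 * g (suc m)  ≈⟨ +-cong (⊛-comm (f ∘ suc) g m) (*-comm _ _) ⟩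
    (g ⊛ (f ∘ suc)) m + g (suc m) * f 0  ≈⟨ ⊛-suc-last g f m ⟨
    (g ⊛ f) (suc m)                      ∎
    where open ≈-Reasoning

  ⊛-scaleˡ : ∀ a f g m → ((λ i → a * f i) ⊛ g) m ≈ a * (f ⊛ g) m
  ⊛-scaleˡ a f g m = trans
    (sum-cong-≋ {suc m} λ i → *-assoc a (f (toℕ i)) (g (m ℕ.∸ toℕ i)))
    (sym (*-distribˡ-sum {suc m} a (λ i → f (toℕ i) * g (m ℕ.∸ toℕ i))))

  ⊛-assoc : ∀ f g h → (f ⊛ g) ⊛ h ≋ f ⊛ (g ⊛ h)
  ⊛-assoc f g h zero = +-congʳ (begin
    (f 0 * g 0 + 0#) * h 0  ≈⟨ *-congʳ (+-identityʳ _) ⟩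
    f 0 * g 0 * h 0         ≈⟨ *-assoc _ _ _ ⟩
    f 0 * (g 0 * h 0)       ≈⟨ *-congˡ (+-identityʳ _) ⟨
    f 0 * (g 0 * h 0 + 0#)  ∎)
    where open ≈-Reasoning
  ⊛-assoc f g h (suc m) = begin
    -- The shift of `f ⊛ g` is `f 0` times `g ∘ suc` plus `f′ ⊛ g`, so distributing over `h` leaves
    -- associativity for `f′`.
    (f 0 * g 0 + 0#) * h (suc m) + (((λ i → f 0 * g (suc i)) ⊕ f′ ⊛ g) ⊛ h) m
      ≈⟨ +-cong (trans (*-congʳ (+-identityʳ _)) (*-assoc _ _ _))
                (⊛-distribʳ h (λ i → f 0 * g (suc i)) (f′ ⊛ g) m) ⟩
    f 0 * (g 0 * h (suc m)) + (((λ i → f 0 * g (suc i)) ⊛ h) m + (f′ ⊛ g ⊛ h) m)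
      ≈⟨ +-congˡ (+-cong (⊛-scaleˡ (f 0) (g ∘ suc) h m) (⊛-assoc f′ g h m)) ⟩
    f 0 * (g 0 * h (suc m)) + (f 0 * ((g ∘ suc) ⊛ h) m + (f′ ⊛ (g ⊛ h)) m)
      ≈⟨ +-assoc _ _ _ ⟨
    f 0 * (g 0 * h (suc m)) + f 0 * ((g ∘ suc) ⊛ h) m + (f′ ⊛ (g ⊛ h)) m
      ≈⟨ +-congʳ (distribˡ _ _ _) ⟨
    f 0 * (g ⊛ h) (suc m) + (f′ ⊛ (g ⊛ h)) m ∎
    where
    open ≈-Reasoning
    f′ = f ∘ suc

  ⊛-identityˡ : ∀ f → 𝟙 ⊛ f ≋ f
  ⊛-identityˡ f m = trans (⊛-cong {g = f} 𝟙≋C (λ _ → refl) m) (trans (C⊛ 1# f m) (*-identityˡ _))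

  powerSeriesCommutativeSemiring : CommutativeSemiring c ℓ₁
  powerSeriesCommutativeSemiring = record
    { isCommutativeSemiring = isCommutativeSemiringˡ record
      { +-isCommutativeMonoid = ⊕.isCommutativeMonoid
      ; *-isCommutativeMonoid = record
        { isMonoid = record
          { isSemigroup = record
            { isMagma = record
              { isEquivalence = ⊕.isEquivalence
              ; ∙-cong = ⊛-cong
              }
            ; assoc = ⊛-assoc
            }
          ; identity = ⊛-identityˡ , λ f m → trans (⊛-comm f 𝟙 m) (⊛-identityˡ f m)
          }
        ; comm = ⊛-comm
        }
      ; distribʳ = ⊛-distribʳ
      ; zeroˡ = ⊛-zeroˡ
      }
    }
    where module ⊕ = CommutativeMonoid (Pointwise.commutativeMonoid ℕ +-commutativeMonoid)

  module S = CommutativeSemiring powerSeriesCommutativeSemiring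
  -- Taken over the multiplicative monoid, so its lemmas on `sum` are lemmas on `∏`.
  module S-Product = MonoidSum S.*-commutativeMonoid
  module ≋-Reasoning = SetoidReasoning S.setoid

  -- Substitution: congruence, linearity and Horner's rule

  ^ˢ-cong[] : ∀ n {F G} k → F ≋[ n ] G → F ^ˢ k ≋[ n ] G ^ˢ k
  ^ˢ-cong[] n zero    p = λ _ _ → refl
  ^ˢ-cong[] n (suc k) p = ⊛-cong[] n p (^ˢ-cong[] n k p)

  ⟪⟫-cong[] : ∀ n {h h′ F G} → h ≋[ n ] h′ → F ≋[ n ] G → h ⟪ F ⟫ ≋[ n ] h′ ⟪ G ⟫
  ⟪⟫-cong[] n p q m m<n = sum-cong-≋ {suc m} λ k →
    *-cong (p (toℕ k) (ℕ.<-≤-trans (toℕ<n k) m<n)) (^ˢ-cong[] n (toℕ k) q m m<n)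

  ⟪⟫-cong : ∀ {h h′ F G} → h ≋ h′ → F ≋ G → h ⟪ F ⟫ ≋ h′ ⟪ G ⟫
  ⟪⟫-cong p q = ≋[]⇒≋ λ n → ⟪⟫-cong[] n (≋⇒≋[] n p) (≋⇒≋[] n q)

  ⟪⟫-⊕ : ∀ f h F → (f ⊕ h) ⟪ F ⟫ ≋ f ⟪ F ⟫ ⊕ h ⟪ F ⟫
  ⟪⟫-⊕ f h F m = trans
    (sum-cong-≋ {suc m} λ k → distribʳ ((F ^ˢ toℕ k) m) (f (toℕ k)) (h (toℕ k)))
    (∑-distrib-+ {suc m} (λ k → f (toℕ k) * (F ^ˢ toℕ k) m) (λ k → h (toℕ k) * (F ^ˢ toℕ k) m))

  ⟪⟫-C⊛ : ∀ a h F → (C a ⊛ h) ⟪ F ⟫ ≋ C a ⊛ h ⟪ F ⟫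
  ⟪⟫-C⊛ a h F m = begin
    ((C a ⊛ h) ⟪ F ⟫) m
      ≈⟨ sum-cong-≋ {suc m} (λ k → trans (*-congʳ (C⊛ a h (toℕ k))) (*-assoc a (h (toℕ k)) ((F ^ˢ toℕ k) m))) ⟩
    sum {suc m} (λ k → a * (h (toℕ k) * (F ^ˢ toℕ k) m))
      ≈⟨ *-distribˡ-sum {suc m} a (λ k → h (toℕ k) * (F ^ˢ toℕ k) m) ⟨
    a * (h ⟪ F ⟫) m
      ≈⟨ C⊛ a (h ⟪ F ⟫) m ⟨
    (C a ⊛ h ⟪ F ⟫) m ∎
    where open ≈-Reasoning

  𝟘⟪⟫ : ∀ F → 𝟘 ⟪ F ⟫ ≋ 𝟘
  𝟘⟪⟫ F m = trans (sum-cong-≋ {suc m} λ k → zeroˡ ((F ^ˢ toℕ k) m)) (sum-replicate-zero (suc m))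

  -- In `_⟪_⟫` the number of terms varies with the coefficient. Fixing it at `N` gives a genuine
  -- finite combination of powers of `F`, from which `F` can be factored out.
  partialSubst : ℕ → PowerSeries → PowerSeries → PowerSeries
  partialSubst N h F m = sum {N} λ k → h (toℕ k) * (F ^ˢ toℕ k) m

  ⊛-linear-combination : ∀ F N (a : Fin N → Carrier) (u : Fin N → PowerSeries) →
    F ⊛ (λ m → sum λ k → a k * u k m) ≋ λ m → sum λ k → a k * (F ⊛ u k) m
  ⊛-linear-combination F zero    a u = S.zeroʳ F
  ⊛-linear-combination F (suc N) a u m = begin
    (F ⊛ (a₀u₀ ⊕ rest)) m
      ≈⟨ S.distribˡ F a₀u₀ rest m ⟩
    (F ⊛ a₀u₀) m + (F ⊛ rest) m
      ≈⟨ +-cong (trans (⊛-comm F a₀u₀ m) (trans (⊛-scaleˡ (a zero) (u zero) F m) (*-congˡ (⊛-comm (u zero) F m))))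
                (⊛-linear-combination F N (a ∘ suc) (u ∘ suc) m) ⟩
    a zero * (F ⊛ u zero) m + sum (λ k → a (suc k) * (F ⊛ u (suc k)) m) ∎
    where
    open ≈-Reasoning
    a₀u₀ rest : PowerSeries
    a₀u₀ m = a zero * u zero m
    rest m = sum λ k → a (suc k) * u (suc k) m

  -- Horner's rule: `F ^ˢ suc k` is `F ⊛ F ^ˢ k`, so all terms after the first share a factor `F`.
  partialSubst-suc : ∀ N h F → partialSubst (suc N) h F ≋ C (h 0) ⊕ F ⊛ partialSubst N (h ∘ suc) F
  partialSubst-suc N h F m = +-cong (h₀𝟙 m)
    (sym (⊛-linear-combination F N (λ k → h (suc (toℕ k))) (λ k → F ^ˢ toℕ k) m))
    where
    h₀𝟙 : ∀ m → h 0 * 𝟙 m ≈ C (h 0) m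
    h₀𝟙 zero    = *-identityʳ _
    h₀𝟙 (suc _) = zeroʳ _

  -- The additional term is a multiple of the `N`-th power of `F`, which starts no earlier than
  -- degree `N`. In the induction, each Horner layer gains one order by contraction.
  partialSubst-step : ∀ N h {F} → F 0 ≈ 0# → partialSubst N h F ≋[ N ] partialSubst (suc N) h F
  partialSubst-step zero    h F₀≈0 i ()
  partialSubst-step (suc N) h {F} F₀≈0 i i<1+N = begin
    partialSubst (suc N) h F i
      ≈⟨ partialSubst-suc N h F i ⟩
    C (h 0) i + (F ⊛ partialSubst N (h ∘ suc) F) i
      ≈⟨ +-congˡ (⊛-contractʳ N {f = F} F₀≈0 (partialSubst-step N (h ∘ suc) F₀≈0) i i<1+N) ⟩
    C (h 0) i + (F ⊛ partialSubst (suc N) (h ∘ suc) F) i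
      ≈⟨ partialSubst-suc (suc N) h F i ⟨
    partialSubst (suc (suc N)) h F i ∎
    where open ≈-Reasoning

  ⟪⟫≋[]partialSubst : ∀ N h {F} → F 0 ≈ 0# → h ⟪ F ⟫ ≋[ N ] partialSubst N h F
  ⟪⟫≋[]partialSubst N h {F} F₀≈0 i i<N = go (ℕ.≤⇒≤′ i<N)
    where
    go : ∀ {N} → suc i ≤′ N → (h ⟪ F ⟫) i ≈ partialSubst N h F i
    -- `(h ⟪ F ⟫) i` is by definition `partialSubst (suc i) h F i`.
    go ≤′-refl        = refl
    go (≤′-step 1+i≤N) = trans (go 1+i≤N) (partialSubst-step _ h F₀≈0 i (ℕ.≤′⇒≤ 1+i≤N))

  -- h(F) = h₀ + F·h′(F) where h = h₀ + x h′.  When F₀ = 0 the right-hand side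
  -- determines each coefficient from earlier ones of h′(F), so identities about
  -- substitution follow by induction on the truncation order.
  ⟪⟫-unfold : ∀ h {F} → F 0 ≈ 0# → h ⟪ F ⟫ ≋ C (h 0) ⊕ F ⊛ (h ∘ suc) ⟪ F ⟫
  ⟪⟫-unfold h {F} F₀≈0 m = trans (partialSubst-suc m h F m)
    (+-congˡ (sym (⊛-contractʳ m {f = F} F₀≈0 (⟪⟫≋[]partialSubst m (h ∘ suc) F₀≈0) m (ℕ.n<1+n m))))

  -- Substitution: units, products and associativity

  C⟪⟫ : ∀ a {F} → F 0 ≈ 0# → C a ⟪ F ⟫ ≋ C a
  C⟪⟫ a {F} F₀≈0 = begin
    C a ⟪ F ⟫           ≈⟨ ⟪⟫-unfold (C a) F₀≈0 ⟩
    C a ⊕ F ⊛ 𝟘 ⟪ F ⟫   ≈⟨ S.+-congˡ (S.trans (S.*-congˡ {F} (𝟘⟪⟫ F)) (S.zeroʳ F)) ⟩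
    C a ⊕ 𝟘             ≈⟨ S.+-identityʳ (C a) ⟩
    C a                 ∎
    where open ≋-Reasoning

  𝟙⟪⟫ : ∀ {F} → F 0 ≈ 0# → 𝟙 ⟪ F ⟫ ≋ 𝟙
  𝟙⟪⟫ {F} F₀≈0 = begin
    𝟙 ⟪ F ⟫     ≈⟨ ⟪⟫-cong {F = F} 𝟙≋C (λ _ → refl) ⟩
    C 1# ⟪ F ⟫  ≈⟨ C⟪⟫ 1# F₀≈0 ⟩
    C 1#        ≈⟨ 𝟙≋C ⟨
    𝟙           ∎
    where open ≋-Reasoning

  X∘suc≋𝟙 : X ∘ suc ≋ 𝟙
  X∘suc≋𝟙 zero    = refl
  X∘suc≋𝟙 (suc _) = refl

  X⟪⟫ : ∀ {F} → F 0 ≈ 0# → X ⟪ F ⟫ ≋ F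
  X⟪⟫ {F} F₀≈0 = begin
    X ⟪ F ⟫                    ≈⟨ ⟪⟫-unfold X F₀≈0 ⟩
    C 0# ⊕ F ⊛ (X ∘ suc) ⟪ F ⟫ ≈⟨ S.+-cong C0≋𝟘 (S.*-congˡ {F} (⟪⟫-cong {F = F} X∘suc≋𝟙 (λ _ → refl))) ⟩
    𝟘 ⊕ F ⊛ 𝟙 ⟪ F ⟫            ≈⟨ S.+-identityˡ _ ⟩
    F ⊛ 𝟙 ⟪ F ⟫                ≈⟨ S.*-congˡ {F} (𝟙⟪⟫ F₀≈0) ⟩
    F ⊛ 𝟙                      ≈⟨ S.*-identityʳ F ⟩
    F                          ∎
    where
    open ≋-Reasoning
    C0≋𝟘 : C 0# ≋ 𝟘
    C0≋𝟘 zero    = refl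
    C0≋𝟘 (suc _) = refl

  X⊛-suc : ∀ f m → (X ⊛ f) (suc m) ≈ f m
  X⊛-suc f m = begin
    0# * f (suc m) + ((X ∘ suc) ⊛ f) m ≈⟨ +-congʳ (zeroˡ _) ⟩
    0# + ((X ∘ suc) ⊛ f) m             ≈⟨ +-identityˡ _ ⟩
    ((X ∘ suc) ⊛ f) m                  ≈⟨ S.*-congʳ {f} X∘suc≋𝟙 m ⟩
    (𝟙 ⊛ f) m                          ≈⟨ ⊛-identityˡ f m ⟩
    f m                                ∎
    where open ≈-Reasoning

  ⟪⟫-zero : ∀ h F → (h ⟪ F ⟫) 0 ≈ h 0
  ⟪⟫-zero h F = trans (+-identityʳ _) (*-identityʳ _)

  ⟪⟫-suc : ∀ h {F} m → F 0 ≈ 0# → (h ⟪ F ⟫) (suc m) ≈ (F ⊛ (h ∘ suc) ⟪ F ⟫) (suc m)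
  ⟪⟫-suc h m F₀≈0 = trans (⟪⟫-unfold h F₀≈0 (suc m)) (+-identityˡ _)

  ⟪X⟫ : ∀ h → h ⟪ X ⟫ ≋ h
  ⟪X⟫ h zero    = ⟪⟫-zero h X
  ⟪X⟫ h (suc m) = trans (⟪⟫-suc h m refl)
    (trans (X⊛-suc ((h ∘ suc) ⟪ X ⟫) m) (⟪X⟫ (h ∘ suc) m))

  -- Both sides unfold to `C ((f ⊛ h) 0) ⊕ F ⊛ _`, and what stands under `F` differs only by the
  -- claim for `f ∘ suc` and `h`. Agreement there below `n` becomes agreement below `suc n` by
  -- contraction.
  ⟪⟫-⊛ : ∀ f h {F} → F 0 ≈ 0# → (f ⊛ h) ⟪ F ⟫ ≋ f ⟪ F ⟫ ⊛ h ⟪ F ⟫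
  ⟪⟫-⊛ f h {F} F₀≈0 = ≋[]⇒≋ λ n → go n f h
    where
    ∘suc-⊛ : ∀ f h → (f ⊛ h) ∘ suc ≋ C (f 0) ⊛ (h ∘ suc) ⊕ (f ∘ suc) ⊛ h
    ∘suc-⊛ f h m = +-congʳ (sym (C⊛ (f 0) (h ∘ suc) m))

    -- `a * b + 0#` is the form to which `(f ⊛ h) 0` computes.
    C-* : ∀ a b → C (a * b + 0#) ≋ C a ⊛ C b
    C-* a b zero    = refl
    C-* a b (suc m) = sym (trans (C⊛ a (C b) (suc m)) (zeroʳ a))

    left : ∀ f h → (f ⊛ h) ⟪ F ⟫ ≋
      C ((f ⊛ h) 0) ⊕ F ⊛ (C (f 0) ⊛ (h ∘ suc) ⟪ F ⟫ ⊕ ((f ∘ suc) ⊛ h) ⟪ F ⟫)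
    left f h = begin
      (f ⊛ h) ⟪ F ⟫
        ≈⟨ ⟪⟫-unfold (f ⊛ h) F₀≈0 ⟩
      C ((f ⊛ h) 0) ⊕ F ⊛ ((f ⊛ h) ∘ suc) ⟪ F ⟫
        ≈⟨ S.+-congˡ (S.*-congˡ {F} (⟪⟫-cong {F = F} (∘suc-⊛ f h) (λ _ → refl))) ⟩
      C ((f ⊛ h) 0) ⊕ F ⊛ (C (f 0) ⊛ (h ∘ suc) ⊕ (f ∘ suc) ⊛ h) ⟪ F ⟫
        ≈⟨ S.+-congˡ (S.*-congˡ {F} (⟪⟫-⊕ (C (f 0) ⊛ (h ∘ suc)) ((f ∘ suc) ⊛ h) F)) ⟩
      C ((f ⊛ h) 0) ⊕ F ⊛ ((C (f 0) ⊛ (h ∘ suc)) ⟪ F ⟫ ⊕ ((f ∘ suc) ⊛ h) ⟪ F ⟫)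
        ≈⟨ S.+-congˡ (S.*-congˡ {F} (S.+-congʳ (⟪⟫-C⊛ (f 0) (h ∘ suc) F))) ⟩
      C ((f ⊛ h) 0) ⊕ F ⊛ (C (f 0) ⊛ (h ∘ suc) ⟪ F ⟫ ⊕ ((f ∘ suc) ⊛ h) ⟪ F ⟫) ∎
      where open ≋-Reasoning

    right : ∀ f h →
      C ((f ⊛ h) 0) ⊕ F ⊛ (C (f 0) ⊛ (h ∘ suc) ⟪ F ⟫ ⊕ (f ∘ suc) ⟪ F ⟫ ⊛ h ⟪ F ⟫) ≋ f ⟪ F ⟫ ⊛ h ⟪ F ⟫
    right f h = begin
      C ((f ⊛ h) 0) ⊕ F ⊛ (C (f 0) ⊛ h′F ⊕ f′F ⊛ hF)
        ≈⟨ S.+-cong (C-* (f 0) (h 0)) (S.distribˡ F (C (f 0) ⊛ h′F) (f′F ⊛ hF)) ⟩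
      C (f 0) ⊛ C (h 0) ⊕ (F ⊛ (C (f 0) ⊛ h′F) ⊕ F ⊛ (f′F ⊛ hF))
        ≈⟨ S.+-assoc (C (f 0) ⊛ C (h 0)) (F ⊛ (C (f 0) ⊛ h′F)) (F ⊛ (f′F ⊛ hF)) ⟨
      C (f 0) ⊛ C (h 0) ⊕ F ⊛ (C (f 0) ⊛ h′F) ⊕ F ⊛ (f′F ⊛ hF)
        ≈⟨ S.+-cong (S.+-congˡ {C (f 0) ⊛ C (h 0)} (x∙yz≈y∙xz F (C (f 0)) h′F)) (S.sym (⊛-assoc F f′F hF)) ⟩
      C (f 0) ⊛ C (h 0) ⊕ C (f 0) ⊛ (F ⊛ h′F) ⊕ F ⊛ f′F ⊛ hF
        ≈⟨ S.+-congʳ {F ⊛ f′F ⊛ hF} (S.distribˡ (C (f 0)) (C (h 0)) (F ⊛ h′F)) ⟨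
      C (f 0) ⊛ (C (h 0) ⊕ F ⊛ h′F) ⊕ F ⊛ f′F ⊛ hF
        ≈⟨ S.+-congʳ {F ⊛ f′F ⊛ hF} (S.*-congˡ {C (f 0)} (⟪⟫-unfold h F₀≈0)) ⟨
      C (f 0) ⊛ hF ⊕ F ⊛ f′F ⊛ hF
        ≈⟨ ⊛-distribʳ hF (C (f 0)) (F ⊛ f′F) ⟨
      (C (f 0) ⊕ F ⊛ f′F) ⊛ hF
        ≈⟨ S.*-congʳ {hF} (⟪⟫-unfold f F₀≈0) ⟨
      f ⟪ F ⟫ ⊛ hF ∎
      where
      open ≋-Reasoning
      open CommutativeSemigroupProperties S.*-commutativeSemigroup using (x∙yz≈y∙xz)
      hF  = h ⟪ F ⟫
      h′F = (h ∘ suc) ⟪ F ⟫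
      f′F = (f ∘ suc) ⟪ F ⟫

    go : ∀ n f h → (f ⊛ h) ⟪ F ⟫ ≋[ n ] f ⟪ F ⟫ ⊛ h ⟪ F ⟫
    go zero    f h i ()
    go (suc n) f h i i<1+n = trans (left f h i) (trans
      (+-congˡ (⊛-contractʳ n {F} F₀≈0 (λ j j<n → +-congˡ {(C (f 0) ⊛ (h ∘ suc) ⟪ F ⟫) j} (go n (f ∘ suc) h j j<n)) i i<1+n))
      (right f h i))

  -- Both sides unfold to `C (h 0) ⊕ F ⟪ K ⟫ ⊛ _` with the claim for `h ∘ suc` underneath;
  -- multiplicativity of substitution is what carries `K` past the factor `F`.
  ⟪⟫-assoc : ∀ h {F K} → F 0 ≈ 0# → K 0 ≈ 0# → h ⟪ F ⟫ ⟪ K ⟫ ≋ h ⟪ F ⟪ K ⟫ ⟫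
  ⟪⟫-assoc h {F} {K} F₀≈0 K₀≈0 = ≋[]⇒≋ λ n → go n h
    where
    FK₀≈0 : (F ⟪ K ⟫) 0 ≈ 0#
    FK₀≈0 = trans (⟪⟫-zero F K) F₀≈0

    left : ∀ h → h ⟪ F ⟫ ⟪ K ⟫ ≋ C (h 0) ⊕ F ⟪ K ⟫ ⊛ (h ∘ suc) ⟪ F ⟫ ⟪ K ⟫
    left h = begin
      h ⟪ F ⟫ ⟪ K ⟫
        ≈⟨ ⟪⟫-cong {F = K} (⟪⟫-unfold h F₀≈0) (λ _ → refl) ⟩
      (C (h 0) ⊕ F ⊛ (h ∘ suc) ⟪ F ⟫) ⟪ K ⟫
        ≈⟨ ⟪⟫-⊕ (C (h 0)) (F ⊛ (h ∘ suc) ⟪ F ⟫) K ⟩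
      C (h 0) ⟪ K ⟫ ⊕ (F ⊛ (h ∘ suc) ⟪ F ⟫) ⟪ K ⟫
        ≈⟨ S.+-cong (C⟪⟫ (h 0) K₀≈0) (⟪⟫-⊛ F ((h ∘ suc) ⟪ F ⟫) K₀≈0) ⟩
      C (h 0) ⊕ F ⟪ K ⟫ ⊛ (h ∘ suc) ⟪ F ⟫ ⟪ K ⟫ ∎
      where open ≋-Reasoning

    go : ∀ n h → h ⟪ F ⟫ ⟪ K ⟫ ≋[ n ] h ⟪ F ⟪ K ⟫ ⟫
    go zero    h i ()
    go (suc n) h i i<1+n = trans (left h i) (trans
      (+-congˡ (⊛-contractʳ n {F ⟪ K ⟫} FK₀≈0 (go n (h ∘ suc)) i i<1+n))
      (sym (⟪⟫-unfold h FK₀≈0 i)))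

  ⟪⟫-∏ : ∀ n (t : Fin n → PowerSeries) {F} → F 0 ≈ 0# → (∏ t) ⟪ F ⟫ ≋ ∏ (λ i → t i ⟪ F ⟫)
  ⟪⟫-∏ zero    t F₀≈0 = 𝟙⟪⟫ F₀≈0
  ⟪⟫-∏ (suc n) t {F} F₀≈0 = S.trans (⟪⟫-⊛ (t zero) (∏ (t ∘ suc)) F₀≈0)
    (S.*-congˡ {t zero ⟪ F ⟫} (⟪⟫-∏ n (t ∘ suc) F₀≈0))

  -- Leading coefficients and perturbation of the identity

  -- Two indices with sum `s ℕ.+ r` are either exactly `s` and `r`, or one of them is too small and
  -- its coefficient vanishes.
  ⊛-lead : ∀ s r f g → f ≋[ s ] 𝟘 → g ≋[ r ] 𝟘 → (f ⊛ g) (s ℕ.+ r) ≈ f s * g r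
  ⊛-lead zero zero    f g p q = +-identityʳ _
  ⊛-lead zero (suc r) f g p q = trans
    (+-congˡ (trans (⊛-cong[] (suc r) {f ∘ suc} (λ _ _ → refl) q r (ℕ.n<1+n r)) (S.zeroʳ (f ∘ suc) r)))
    (+-identityʳ _)
  ⊛-lead (suc s) r f g p q = trans
    (+-cong (trans (*-congʳ (p 0 z<s)) (zeroˡ _))
            (⊛-lead s r (f ∘ suc) g (λ i i<s → p (suc i) (s<s i<s)) q))
    (+-identityˡ _)

  ⟪⟫-order : ∀ r {h} F → h ≋[ r ] 𝟘 → h ⟪ F ⟫ ≋[ r ] 𝟘
  ⟪⟫-order r F p i i<r = trans (⟪⟫-cong[] r {F = F} p (λ _ _ → refl) i i<r) (𝟘⟪⟫ F i)

  -- Each unfolding strips one factor `F = x + ...`, whose leading coefficient is `1#`.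
  ⟪⟫-lead : ∀ r h {F} → F 0 ≈ 0# → F 1 ≈ 1# → h ≋[ r ] 𝟘 → (h ⟪ F ⟫) r ≈ h r
  ⟪⟫-lead zero    h {F} F₀≈0 F₁≈1 p = ⟪⟫-zero h F
  ⟪⟫-lead (suc r) h {F} F₀≈0 F₁≈1 p = begin
    (h ⟪ F ⟫) (suc r)
      ≈⟨ ⟪⟫-suc h r F₀≈0 ⟩
    (F ⊛ (h ∘ suc) ⟪ F ⟫) (suc r)
      ≈⟨ ⊛-lead 1 r F ((h ∘ suc) ⟪ F ⟫) (λ { zero _ → F₀≈0 ; (suc _) (s≤s ()) }) (⟪⟫-order r F p′) ⟩
    F 1 * ((h ∘ suc) ⟪ F ⟫) r
      ≈⟨ *-cong F₁≈1 (⟪⟫-lead r (h ∘ suc) F₀≈0 F₁≈1 p′) ⟩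
    1# * h (suc r)
      ≈⟨ *-identityˡ _ ⟩
    h (suc r) ∎
    where
    open ≈-Reasoning
    p′ : h ∘ suc ≋[ r ] 𝟘
    p′ i i<r = p (suc i) (s<s i<r)

  -- The lowest-order perturbation of h(x) under x ↦ x + d xˢ + ⋯ is that of its
  -- leading term: h_r (x + d xˢ)ʳ = h_r xʳ + r h_r d x^(r+s-1) + ⋯.
  ⟪⟫-perturb : ∀ {H D} t → H ≋ X ⊕ D → H 0 ≈ 0# → H 1 ≈ 1# → D ≋[ suc t ] 𝟘 →
    ∀ r h → (∀ i → 0 < i → i < r → h i ≈ 0#) →
    (h ⟪ H ⟫) (t ℕ.+ r) ≈ h (t ℕ.+ r) + r · (h r * D (suc t))
  ⟪⟫-perturb {H} {D} t H≋X⊕D H₀≈0 H₁≈1 D≋0 zero h p rewrite ℕ.+-identityʳ t = begin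
    (h ⟪ H ⟫) t  ≈⟨ ⟪⟫-cong[] (suc t) {h} (λ _ _ → refl) H≋X t (ℕ.n<1+n t) ⟩
    (h ⟪ X ⟫) t  ≈⟨ ⟪X⟫ h t ⟩
    h t          ≈⟨ +-identityʳ _ ⟨
    h t + 0#     ∎
    where
    open ≈-Reasoning
    H≋X : H ≋[ suc t ] X
    H≋X i i<1+t = trans (H≋X⊕D i) (trans (+-congˡ (D≋0 i i<1+t)) (+-identityʳ _))
  ⟪⟫-perturb {H} {D} t H≋X⊕D H₀≈0 H₁≈1 D≋0 (suc r) h p rewrite ℕ.+-suc t r = begin
    (h ⟪ H ⟫) (suc (t ℕ.+ r))
      ≈⟨ ⟪⟫-suc h (t ℕ.+ r) H₀≈0 ⟩
    (H ⊛ h′H) (suc (t ℕ.+ r))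
      ≈⟨ S.*-congʳ {h′H} H≋X⊕D (suc (t ℕ.+ r)) ⟩
    ((X ⊕ D) ⊛ h′H) (suc (t ℕ.+ r))
      ≈⟨ ⊛-distribʳ h′H X D (suc (t ℕ.+ r)) ⟩
    -- The `X` part carries the `r` copies of `hD` from the induction hypothesis for `h ∘ suc`; the
    -- `D` part adds one more, as a product of leading coefficients.
    (X ⊛ h′H) (suc (t ℕ.+ r)) + (D ⊛ h′H) (suc t ℕ.+ r)
      ≈⟨ +-cong (X⊛-suc h′H (t ℕ.+ r)) (⊛-lead (suc t) r D h′H D≋0 (⟪⟫-order r H h′≋0)) ⟩
    h′H (t ℕ.+ r) + D (suc t) * h′H r
      ≈⟨ +-cong (⟪⟫-perturb t H≋X⊕D H₀≈0 H₁≈1 D≋0 r (h ∘ suc) (λ i _ i<r → h′≋0 i i<r))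
                (trans (*-comm _ _) (*-congʳ (⟪⟫-lead r (h ∘ suc) H₀≈0 H₁≈1 h′≋0))) ⟩
    h (suc (t ℕ.+ r)) + r · hD + hD
      ≈⟨ +-assoc _ _ _ ⟩
    h (suc (t ℕ.+ r)) + (r · hD + hD)
      ≈⟨ +-congˡ (+-comm _ _) ⟩
    h (suc (t ℕ.+ r)) + suc r · hD ∎
    where
    open ≈-Reasoning
    h′H = (h ∘ suc) ⟪ H ⟫
    hD = h (suc r) * D (suc t)
    h′≋0 : h ∘ suc ≋[ r ] 𝟘
    h′≋0 i i<r = p (suc i) z<s (s<s i<r)

  ⟪⟫-fixed⇒≋X : CharacteristicZero → ∀ {H} → H 0 ≈ 0# → H 1 ≈ 1# →
    ∀ g r → 0 < r → (∀ i → 0 < i → i < r → g i ≈ 0#) → g r # 0# →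
    g ⟪ H ⟫ ≋ g → H ≋ X
  -- Matching `r` as a successor supplies the `NonZero` instance for `char0 r`.
  ⟪⟫-fixed⇒≋X char0 {H} H₀≈0 H₁≈1 g r@(suc _) _ low gᵣ#0 gH≋g i =
    trans (H≋X⊕D i) (trans (+-congˡ (D≋[] i i (ℕ.m<n⇒m<1+n (ℕ.n<1+n i)))) (+-identityʳ _))
    where
    -- `D` is `H - X`, written by cases so that its first two coefficients are `0#` by computation.
    D : PowerSeries
    D (suc (suc i)) = H (suc (suc i))
    D _             = 0#

    H≋X⊕D : H ≋ X ⊕ D
    H≋X⊕D 0             = trans H₀≈0 (sym (+-identityʳ _))
    H≋X⊕D 1             = trans H₁≈1 (sym (+-identityʳ _))
    H≋X⊕D (suc (suc i)) = sym (+-identityˡ _)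

    step : ∀ t → D ≋[ suc t ] 𝟘 → D (suc t) ≈ 0#
    step t D≋0 = x#0∧xy≈0⇒y≈0 (x#0y#0→xy#0 (char0 r) gᵣ#0) (begin
      (r · 1#) * g r * D (suc t)    ≈⟨ *-assoc _ _ _ ⟩
      (r · 1#) * (g r * D (suc t))  ≈⟨ ×-assoc-* r 1# _ ⟩
      r · (1# * (g r * D (suc t)))  ≈⟨ ×-congʳ r (*-identityˡ _) ⟩
      -- Since `g ⟪ H ⟫` and `g` agree at `t ℕ.+ r`, the perturbation term there must vanish.
      r · (g r * D (suc t))         ≈⟨ identityʳ-unique (g (t ℕ.+ r)) _
                                         (trans (sym (⟪⟫-perturb t H≋X⊕D H₀≈0 H₁≈1 D≋0 r g low)) (gH≋g (t ℕ.+ r))) ⟩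
      0#                            ∎)
      where
      open ≈-Reasoning
      open GroupProperties +-group using (identityʳ-unique)

    D≋[] : ∀ t → D ≋[ suc (suc t) ] 𝟘
    D≋[] zero = λ { 0 _ → refl ; 1 _ → refl ; (suc (suc _)) (s≤s (s≤s ())) }
    -- Orders start at two because `H 0` and `H 1` are prescribed; the next unknown coefficient is
    -- at `suc (suc t)`.
    D≋[] (suc t) = ≋[suc] (D≋[] t) (step (suc t) (D≋[] t))

  -- Iterates of a series and products along them

  module _ {F : PowerSeries} (F₀≈0 : F 0 ≈ 0#) where

    iterate-zero : ∀ j → iterate F j 0 ≈ 0#
    iterate-zero zero    = refl
    iterate-zero (suc j) = trans (⟪⟫-zero F (iterate F j)) F₀≈0

    -- Linear coefficients multiply under composition. A root of unity `F 1` thus yields an iterate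
    -- of the form `x + ...`.
    iterate-one : ∀ j → iterate F j 1 ≈ F 1 ^ j
    iterate-one zero    = refl
    iterate-one (suc j) = begin
      (F ⟪ K ⟫) 1
        ≈⟨ ⟪⟫-suc F {K} 0 (iterate-zero j) ⟩
      (K ⊛ (F ∘ suc) ⟪ K ⟫) 1
        ≈⟨ ⊛-lead 1 0 K ((F ∘ suc) ⟪ K ⟫) (λ { zero _ → iterate-zero j ; (suc _) (s≤s ()) }) (λ _ ()) ⟩
      K 1 * ((F ∘ suc) ⟪ K ⟫) 0
        ≈⟨ *-cong (iterate-one j) (⟪⟫-zero (F ∘ suc) K) ⟩
      F 1 ^ j * F 1
        ≈⟨ *-comm _ _ ⟩
      F 1 * F 1 ^ j ∎
      where
      open ≈-Reasoning
      K = iterate F j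

    -- `iterate` adds each new `F` on the outside, the Riordan product on the inside; associativity
    -- of substitution reconciles them.
    iterate-⟪⟫ : ∀ j → iterate F j ⟪ F ⟫ ≋ iterate F (suc j)
    iterate-⟪⟫ zero    = S.trans (X⟪⟫ F₀≈0) (S.sym (⟪X⟫ F))
    iterate-⟪⟫ (suc j) = S.trans (⟪⟫-assoc F {iterate F j} (iterate-zero j) F₀≈0)
      (⟪⟫-cong {F} (λ _ → refl) (iterate-⟪⟫ j))

    -- Substituting `F` raises every iterate index by one, and the prefactor `g` fills the vacated
    -- index zero because `iterate F 0` is `X`.
    ∏-iterate-suc : ∀ g n → g ⊛ (∏ {n} (λ j → g ⟪ iterate F (toℕ j) ⟫)) ⟪ F ⟫ ≋
                            ∏ {suc n} (λ j → g ⟪ iterate F (toℕ j) ⟫)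
    ∏-iterate-suc g n = ⊛-cong (S.sym (⟪X⟫ g)) (S.trans
      (⟪⟫-∏ n (λ j → g ⟪ iterate F (toℕ j) ⟫) F₀≈0)
      (S-Product.sum-cong-≋ {n} λ j → S.trans
        (⟪⟫-assoc g (iterate-zero (toℕ j)) F₀≈0)
        (⟪⟫-cong {g} (λ _ → refl) (iterate-⟪⟫ (toℕ j)))))

    ∏-iterate-last : ∀ g n → ∏ {suc n} (λ j → g ⟪ iterate F (toℕ j) ⟫) ≋
                             ∏ {n} (λ j → g ⟪ iterate F (toℕ j) ⟫) ⊛ g ⟪ iterate F n ⟫
    ∏-iterate-last g n = S.trans
      (S-Product.sum-init-last {n} (λ j → g ⟪ iterate F (toℕ j) ⟫))
      (⊛-cong
        (S-Product.sum-cong-≋ {n} λ j → S.reflexive (≡.cong G (toℕ-inject₁ j)))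
        (S.reflexive (≡.cong G (toℕ-fromℕ n))))
      where
      G : ℕ → PowerSeries
      G j = g ⟪ iterate F j ⟫

    ∏≋𝟙⇒fixed : ∀ g n → ∏ {n} (λ j → g ⟪ iterate F (toℕ j) ⟫) ≋ 𝟙 → g ⟪ iterate F n ⟫ ≋ g
    ∏≋𝟙⇒fixed g n P≋𝟙 = begin
      g ⟪ iterate F n ⟫      ≈⟨ ⊛-identityˡ (g ⟪ iterate F n ⟫) ⟨
      𝟙 ⊛ g ⟪ iterate F n ⟫  ≈⟨ S.*-congʳ {g ⟪ iterate F n ⟫} P≋𝟙 ⟨
      P ⊛ g ⟪ iterate F n ⟫  ≈⟨ ∏-iterate-last g n ⟨
      -- The product of `suc n` factors is split at its last factor above and at its first below.
      ∏ {suc n} (λ j → g ⟪ iterate F (toℕ j) ⟫)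
                             ≈⟨ ∏-iterate-suc g n ⟨
      g ⊛ P ⟪ F ⟫            ≈⟨ S.*-congˡ {g} (S.trans (⟪⟫-cong {F = F} P≋𝟙 (λ _ → refl)) (𝟙⟪⟫ F₀≈0)) ⟩
      g ⊛ 𝟙                  ≈⟨ S.*-identityʳ g ⟩
      g                      ∎
      where
      open ≋-Reasoning
      P = ∏ {n} (λ j → g ⟪ iterate F (toℕ j) ⟫)

  -- Components of powers in the Riordan group

  module _ (A : RiordanPair) where
    open RiordanPair A

    ^ᴿ-F : ∀ n → RiordanPair.F (A ^ᴿ n) ≋ iterate F n
    ^ᴿ-F zero    = S.refl
    ^ᴿ-F (suc n) = S.trans (⟪⟫-cong {F = F} (^ᴿ-F n) (λ _ → refl)) (iterate-⟪⟫ F₀≈0 n)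

    ^ᴿ-g : ∀ n → RiordanPair.g (A ^ᴿ n) ≋ ∏ {n} (λ j → g ⟪ iterate F (toℕ j) ⟫)
    ^ᴿ-g zero    = S.refl
    ^ᴿ-g (suc n) = S.trans
      (S.*-congˡ {g} (⟪⟫-cong {F = F} (^ᴿ-g n) (λ _ → refl)))
      (∏-iterate-suc F₀≈0 g n)

theorem3p1 : ∀ {c ℓ₁ ℓ₂} (𝔽 : HeytingField c ℓ₁ ℓ₂) →
    let open HeytingField 𝔽
        open Riordan 𝔽
    in CharacteristicZero →
       (n : ℕ) → .{{_ : NonZero n}} →
       (A : RiordanPair) →
       let open RiordanPair A in
       (r : ℕ) → 0 < r → (∀ i → 0 < i → i < r → g i ≈ 0#) → g r # 0# →
       F 1 ^ n ≈ 1# →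
       (A ^ᴿ n ≈ᴿ εᴿ) ⇔ (∏ {n} (λ j → g ⟪ iterate F (toℕ j) ⟫) ≋ 𝟙)
theorem3p1 𝔽 char0 n A r 0<r low gᵣ#0 F₁ⁿ≈1 = mk⇔
  (λ Aⁿ≈ε → S.trans (S.sym (^ᴿ-g A n)) (proj₁ Aⁿ≈ε))
  (λ P≋𝟙 → S.trans (^ᴿ-g A n) P≋𝟙 ,
    S.trans (^ᴿ-F A n)
      -- The hypothesis on `F 1 ^ n` enters here, making the linear coefficient of `iterate F n`
      -- equal to `1#`.
      (⟪⟫-fixed⇒≋X char0 (iterate-zero F₀≈0 n) (trans (iterate-one F₀≈0 n) F₁ⁿ≈1)
        g r 0<r low gᵣ#0 (∏≋𝟙⇒fixed F₀≈0 g n P≋𝟙)))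
  where
  open HeytingField 𝔽 using (trans)
  open Riordan 𝔽
  open RiordanPair A
  open RiordanPowers 𝔽
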